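{- Let $\mathbb{F}_q$ be a finite field. Let $W$ be a weighing matrix $\mathrm{W}(n,m)$, let $B$ be the $n\times b$ point-by-block incidence matrix of an $(r,\lambda)$-design, and let $G=[\,W \mid B\,]$ be the $n\times(n+b)$ matrix over $\mathbb{F}_q$ obtained by juxtaposing $W$ and $B$ (with entries interpreted in $\mathbb{F}_q$). If $r+(n-1)\lambda+m\neq 0$ and $r-\lambda+m\neq 0$ in $\mathbb{F}_q$, then $G$ generates an LCD code $C$ of length $n+b$ over $\mathbb{F}_q$.
   Context: A weighing matrix $\mathrm{W}(n,m)$ is an $n\times n$ matrix $W$ with entries in $\{0,1,-1\}$ such that $WW^{\top}=mI_n$ over $\mathbb{C}$. An $(r,\lambda)$-design is a pair $(\mathcal{V},\mathcal{B})$, where $\mathcal{V}$ is a finite set of points and $\mathcal{B}$ is a collection of $b$ subsets of $\mathcal{V}$ (blocks), such that each point lies in exactly $r$ blocks and every pair of distinct points lies together in exactly $\lambda$ blocks. Its point-by-block incidence matrix is the $(0,1)$-matrix with rows indexed by points, columns indexed by blocks, and entry $1$ exactly when the point lies in the block. Entries $0,\pm1$ and integers are interpreted in $\mathbb{F}_q$. A matrix over $\mathbb{F}_q$ generates the linear code spanned by its rows. For a linear code $C\subseteq\mathbb{F}_q^N$, $C^\perp$ is its orthogonal complement under the standard inner product, and $C$ is LCD (linear with complementary dual) if $C\cap C^\perp=\{0\}$. -}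

module Defs where

open import Algebra.Apartness.Bundles using (HeytingField; HeytingCommutativeRing)
open import Algebra.Bundles using (CommutativeMonoid; CommutativeRing)
open import Data.Bool.Base using (if_then_else_)
open import Data.Fin.Base using (Fin)
open import Data.Fin.Properties using (_≟_)
open import Data.Fin.Subset using (Subset)
open import Data.Fin.Subset.Properties using (_∈?_)
open import Data.Integer.Base using (ℤ; +_; -[1+_]; 0ℤ; 1ℤ; -1ℤ)
open import Data.Integer.Properties using (+-*-commutativeRing)
open import Data.Nat.Base as ℕ using (ℕ; suc)
open import Data.Product.Base using (_×_; ∃)
open import Data.Sum.Base using (_⊎_)
open import Data.Vec.Base as Vec using (Vec; count)
open import Data.Vec.Functional using (Vector; _++_; transpose)
open import Function.Bundles using (Inverse)
open import Level using (Level; _⊔_)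
open import Relation.Binary.PropositionalEquality using (_≡_; _≢_; setoid)
open import Relation.Nullary.Decidable using (does; _×-dec_)
open import Relation.Nullary.Negation using (¬_)
open import Relation.Unary using (Pred; _∩_; _≐_)

import Algebra.Definitions.RawMonoid as RawMonoidDefs
import Data.Vec.Functional.Relation.Binary.Equality.Setoid as Pointwise

Matrix : {a : Level} → Set a → ℕ → ℕ → Set a
Matrix A n k = Vector (Vector A k) n

[_∣_] : {a : Level} {A : Set a} {n k l : ℕ} →
        Matrix A n k → Matrix A n l → Matrix A n (k ℕ.+ l)
[ M ∣ N ] i = M i ++ N i

module LinearAlgebra {c ℓ : Level} (R : CommutativeRing c ℓ) where
  open CommutativeRing R
  open RawMonoidDefs (CommutativeMonoid.rawMonoid +-commutativeMonoid)
    using (sum) renaming (_×_ to _·_)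

  ⟨_,_⟩ : {N : ℕ} → Vector Carrier N → Vector Carrier N → Carrier
  ⟨ u , v ⟩ = sum (λ j → u j * v j)

  infixl 7 _⊗_ _⊛_
  _⊗_ : {n k l : ℕ} → Matrix Carrier n k → Matrix Carrier k l → Matrix Carrier n l
  (M ⊗ N) i j = ⟨ M i , (λ k → N k j) ⟩

  scalarMatrix : (n : ℕ) → Carrier → Matrix Carrier n n
  scalarMatrix n x i j = if does (i ≟ j) then x else 0#

  _⊛_ : {n k : ℕ} → Vector Carrier n → Matrix Carrier n k → Vector Carrier k
  (a ⊛ M) j = ⟨ a , (λ i → M i j) ⟩

  -- The canonical ring homomorphism ℤ → R.
  fromℤ : ℤ → Carrier
  fromℤ (+ k)    = k · 1#
  fromℤ -[1+ k ] = - (suc k · 1#)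

-- W(n,m).  The entries and m are integers and ℤ embeds in ℂ, so
-- W Wᵀ = m I over ℂ is the same equation read in ℤ.
record IsWeighing {n : ℕ} (W : Matrix ℤ n n) (m : ℕ) : Set where
  open LinearAlgebra +-*-commutativeRing
  field
    entries : ∀ i j → W i j ≡ 0ℤ ⊎ W i j ≡ 1ℤ ⊎ W i j ≡ -1ℤ
    gram    : ∀ i j → (W ⊗ transpose W) i j ≡ scalarMatrix n (+ m) i j

-- An (r,λ)-design with point set Fin n and b blocks.  The blocks are
-- listed, so repeated blocks are allowed and counted with multiplicity.
record Design (n b r lam : ℕ) : Set where
  field
    blocks      : Vec (Subset n) b
    replication : ∀ x → count (x ∈?_) blocks ≡ r
    balance     : ∀ x y → x ≢ y →
                  count (λ β → (x ∈? β) ×-dec (y ∈? β)) blocks ≡ lam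

incidence : {n b r lam : ℕ} → Design n b r lam → Matrix ℤ n b
incidence D x j = if does (x ∈? Vec.lookup (Design.blocks D) j) then 1ℤ else 0ℤ

fieldRing : {c ℓ₁ ℓ₂ : Level} → HeytingField c ℓ₁ ℓ₂ → CommutativeRing c ℓ₁
fieldRing F =
  HeytingCommutativeRing.commutativeRing (HeytingField.heytingCommutativeRing F)

-- On a finite setoid equality and invertibility are decidable, so a
-- Heyting field of finite order is a field in the classical sense and its
-- apartness is the negation of _≈_.
HasOrder : {c ℓ₁ ℓ₂ : Level} → HeytingField c ℓ₁ ℓ₂ → ℕ → Set (c ⊔ ℓ₁)
HasOrder F q =
  Inverse (CommutativeRing.setoid (fieldRing F)) (setoid (Fin q))

module Codes {c ℓ₁ ℓ₂ : Level} (F : HeytingField c ℓ₁ ℓ₂) where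
  open CommutativeRing (fieldRing F)
  open LinearAlgebra (fieldRing F) public
  open Pointwise (CommutativeRing.setoid (fieldRing F)) using (_≋_)

  record IsLinearCode {ℓ : Level} {N : ℕ} (C : Pred (Vector Carrier N) ℓ)
         : Set (c ⊔ ℓ₁ ⊔ ℓ) where
    field
      resp     : ∀ {u v} → u ≋ v → C u → C v
      0-closed : C (λ _ → 0#)
      +-closed : ∀ {u v} → C u → C v → C (λ j → u j + v j)
      *-closed : ∀ x {v} → C v → C (λ j → x * v j)

  _⊥ : {ℓ : Level} {N : ℕ} → Pred (Vector Carrier N) ℓ → Pred (Vector Carrier N) (c ⊔ ℓ₁ ⊔ ℓ)
  (C ⊥) v = ∀ u → C u → ⟨ u , v ⟩ ≈ 0#

  record IsLCD {ℓ : Level} {N : ℕ} (C : Pred (Vector Carrier N) ℓ)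
         : Set (c ⊔ ℓ₁ ⊔ ℓ) where
    field
      isLinearCode      : IsLinearCode C
      complementaryDual : (C ∩ (C ⊥)) ≐ (λ v → v ≋ (λ _ → 0#))

  rowSpan : {n N : ℕ} → Matrix Carrier n N → Pred (Vector Carrier N) (c ⊔ ℓ₁)
  rowSpan G v = ∃ λ a → v ≋ (a ⊛ G)

  interpret : {n N : ℕ} → Matrix ℤ n N → Matrix Carrier n N
  interpret M i j = fromℤ (M i j)

  infix 4 _≠0
  _≠0 : ℤ → Set ℓ₁
  k ≠0 = ¬ (fromℤ k ≈ 0#)

{-# OPTIONS --safe #-}

-- The Gram matrix of G is G Gᵀ = (r − λ + m) I + λ J.  If a G Gᵀ = 0, then
-- summing the coordinates gives (r + (n − 1)λ + m) Σ a = 0, so Σ a = 0, and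
-- the j-th coordinate reduces to (r − λ + m) aⱼ = 0.  Hence G Gᵀ has trivial
-- left kernel, and a codeword a G orthogonal to every row of G is zero.
module Submission where

open import Defs
open import Algebra.Apartness.Bundles using (HeytingField)
open import Algebra.Bundles using (CommutativeRing)
open import Data.Bool.Base using (Bool; true; false; if_then_else_; _∧_)
open import Data.Bool.Properties using (∧-idem)
open import Data.Fin.Base using (Fin; zero; suc; splitAt)
open import Data.Fin.Properties using (_≟_; punchInᵢ≢i)
open import Data.Fin.Subset.Properties using (_∈?_)
open import Data.Integer.Base using (ℤ; +_; -[1+_]; 0ℤ; 1ℤ; _⊖_; _+_; _-_; _*_; -_)
open import Data.Integer.Properties as ℤ using ([1+m]⊖[1+n]≡m⊖n; +-*-commutativeRing)
open import Data.Integer.Tactic.RingSolver using (solve-∀)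
open import Data.Nat.Base as ℕ using (ℕ; zero; suc)
open import Data.Product.Base using (_×_; _,_; proj₁)
open import Data.Sum.Base using (inj₁; inj₂)
open import Data.Vec.Base as Vec using (Vec; []; _∷_; count)
open import Data.Vec.Functional using (Vector; _++_; removeAt; tail; transpose)
open import Function.Base using (_∘_)
open import Level using (Level)
open import Relation.Binary.PropositionalEquality as ≡ using (_≡_; _≢_; cong; cong₂; module ≡-Reasoning)
open import Relation.Nullary.Decidable using (does; yes; no; _×-dec_)
open import Relation.Nullary.Negation using (¬_; contradiction)
open import Relation.Unary using (Pred; Decidable)

import Algebra.Properties.CommutativeSemigroup as CommutativeSemigroupProperties
import Algebra.Properties.Ring as RingProperties
import Algebra.Properties.Semiring.Mult as SemiringMult
import Algebra.Properties.Semiring.Sum as SemiringSum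
import Data.Vec.Functional.Relation.Binary.Equality.Setoid as Pointwise
import Relation.Binary.Reasoning.Setoid as ≈-Reasoning

-- The canonical ring homomorphism from ℤ to a commutative ring.

module LinearAlgebraProperties {c ℓ : Level} (R : CommutativeRing c ℓ) where
  open CommutativeRing R hiding (zero; _-_) renaming (_+_ to _⊕_; _*_ to _⊙_; -_ to ⊝_)
  open LinearAlgebra R
  open RingProperties ring using (-0#≈0#; -‿involutive; -‿distribˡ-*; -‿distribʳ-*; -‿+-comm)
  open SemiringMult semiring using (×-homo-+; ×1-homo-*) renaming (_×_ to _·_)
  open SemiringSum semiring
  open Pointwise setoid using (_≋_)
  open CommutativeSemigroupProperties (CommutativeRing.+-commutativeSemigroup R)
    using (interchange)
  open ≈-Reasoning setoid

  -- Adding integers of opposite sign computes to `_⊖_`, so this settles the two mixed cases of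
  -- `fromℤ-+`.
  fromℤ-⊖ : ∀ m n → fromℤ (m ⊖ n) ≈ m · 1# ⊕ ⊝ (n · 1#)
  fromℤ-⊖ zero    zero    = sym (-‿inverseʳ 0#)
  fromℤ-⊖ zero    (suc n) = sym (+-identityˡ _)
  fromℤ-⊖ (suc m) zero    = sym (trans (+-congˡ -0#≈0#) (+-identityʳ _))
  fromℤ-⊖ (suc m) (suc n) = begin
    fromℤ (suc m ⊖ suc n)                        ≡⟨ cong fromℤ ([1+m]⊖[1+n]≡m⊖n m n) ⟩
    fromℤ (m ⊖ n)                                ≈⟨ fromℤ-⊖ m n ⟩
    m · 1# ⊕ ⊝ (n · 1#)                          ≈⟨ +-identityˡ _ ⟨
    -- The zero becomes `1# ⊕ ⊝ 1#`, one unit for each of the two successors.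
    0# ⊕ (m · 1# ⊕ ⊝ (n · 1#))                   ≈⟨ +-congʳ (-‿inverseʳ 1#) ⟨
    1# ⊕ ⊝ 1# ⊕ (m · 1# ⊕ ⊝ (n · 1#))            ≈⟨ interchange _ _ _ _ ⟩
    1# ⊕ m · 1# ⊕ (⊝ 1# ⊕ ⊝ (n · 1#))            ≈⟨ +-congˡ (-‿+-comm 1# (n · 1#)) ⟩
    suc m · 1# ⊕ ⊝ (suc n · 1#)                  ∎

  fromℤ-neg : ∀ i → fromℤ (- i) ≈ ⊝ fromℤ i
  fromℤ-neg (+ zero)  = sym -0#≈0#
  fromℤ-neg (+ suc n) = refl
  fromℤ-neg -[1+ n ]  = sym (-‿involutive _)

  fromℤ-+ : ∀ i j → fromℤ (i + j) ≈ fromℤ i ⊕ fromℤ j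
  fromℤ-+ (+ m)    (+ n)    = ×-homo-+ 1# m n
  fromℤ-+ (+ m)    -[1+ n ] = fromℤ-⊖ m (suc n)
  fromℤ-+ -[1+ m ] (+ n)    = trans (fromℤ-⊖ n (suc m)) (+-comm _ _)
  fromℤ-+ -[1+ m ] -[1+ n ] = begin
    fromℤ (-[1+ m ] + -[1+ n ])            ≡⟨ cong fromℤ (ℤ.neg-distrib-+ (+ suc m) (+ suc n)) ⟨
    fromℤ (- (+ suc m + + suc n))          ≈⟨ fromℤ-neg (+ suc m + + suc n) ⟩
    ⊝ ((suc m ℕ.+ suc n) · 1#)             ≈⟨ -‿cong (×-homo-+ 1# (suc m) (suc n)) ⟩
    ⊝ (suc m · 1# ⊕ suc n · 1#)            ≈⟨ -‿+-comm _ _ ⟨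
    ⊝ (suc m · 1#) ⊕ ⊝ (suc n · 1#)        ∎

  -- The sign of the left factor is pulled out in ℤ, which leaves a product of naturals for
  -- `×1-homo-*`; `fromℤ-*` then treats the sign of the right factor in the same way.
  fromℤ-*-pos : ∀ i n → fromℤ (i * + n) ≈ fromℤ i ⊙ (n · 1#)
  fromℤ-*-pos (+ m)    n = begin
    fromℤ (+ m * + n)              ≡⟨ cong fromℤ (ℤ.pos-* m n) ⟨
    (m ℕ.* n) · 1#                 ≈⟨ ×1-homo-* m n ⟩
    (m · 1#) ⊙ (n · 1#)            ∎
  fromℤ-*-pos -[1+ m ] n = begin
    fromℤ (- (+ suc m) * + n)      ≡⟨ cong fromℤ (ℤ.neg-distribˡ-* (+ suc m) (+ n)) ⟨
    fromℤ (- (+ suc m * + n))      ≈⟨ fromℤ-neg (+ suc m * + n) ⟩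
    ⊝ fromℤ (+ suc m * + n)        ≡⟨ cong (⊝_ ∘ fromℤ) (ℤ.pos-* (suc m) n) ⟨
    ⊝ ((suc m ℕ.* n) · 1#)         ≈⟨ -‿cong (×1-homo-* (suc m) n) ⟩
    ⊝ ((suc m · 1#) ⊙ (n · 1#))    ≈⟨ -‿distribˡ-* _ _ ⟩
    fromℤ -[1+ m ] ⊙ (n · 1#)      ∎

  fromℤ-* : ∀ i j → fromℤ (i * j) ≈ fromℤ i ⊙ fromℤ j
  fromℤ-* i (+ n)    = fromℤ-*-pos i n
  fromℤ-* i -[1+ n ] = begin
    fromℤ (i * - (+ suc n))        ≡⟨ cong fromℤ (ℤ.neg-distribʳ-* i (+ suc n)) ⟨
    fromℤ (- (i * + suc n))        ≈⟨ fromℤ-neg (i * + suc n) ⟩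
    ⊝ fromℤ (i * + suc n)          ≈⟨ -‿cong (fromℤ-*-pos i (suc n)) ⟩
    ⊝ (fromℤ i ⊙ (suc n · 1#))     ≈⟨ -‿distribʳ-* _ _ ⟩
    fromℤ i ⊙ fromℤ -[1+ n ]       ∎

  fromℤ-scalarMatrix : ∀ n x i j → fromℤ (LinearAlgebra.scalarMatrix +-*-commutativeRing n x i j)
                       ≈ scalarMatrix n (fromℤ x) i j
  fromℤ-scalarMatrix n x i j with does (i ≟ j)
  ... | true  = refl
  ... | false = refl

  -- Gram entries can thus be computed in ℤ, where the weighing and design axioms live, and
  -- transferred to the ring afterwards.
  fromℤ-⟨⟩ : ∀ {N} (u v : Vector ℤ N) →
             ⟨ fromℤ ∘ u , fromℤ ∘ v ⟩ ≈ fromℤ (LinearAlgebra.⟨_,_⟩ +-*-commutativeRing u v)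
  fromℤ-⟨⟩ {zero}  u v = refl
  fromℤ-⟨⟩ {suc N} u v = sym (trans (fromℤ-+ (u zero * v zero) _)
    (+-cong (fromℤ-* (u zero) (v zero)) (sym (fromℤ-⟨⟩ (tail u) (tail v)))))

  -- Bilinearity of the standard inner product.

  ⟨⟩-cong : ∀ {N} {u u′ v v′ : Vector Carrier N} → u ≋ u′ → v ≋ v′ → ⟨ u , v ⟩ ≈ ⟨ u′ , v′ ⟩
  ⟨⟩-cong u≋u′ v≋v′ = sum-cong-≋ (λ j → *-cong (u≋u′ j) (v≋v′ j))

  ⟨⟩-distribʳ-+ : ∀ {N} (u v w : Vector Carrier N) →
                  ⟨ (λ j → u j ⊕ v j) , w ⟩ ≈ ⟨ u , w ⟩ ⊕ ⟨ v , w ⟩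
  ⟨⟩-distribʳ-+ u v w = trans (sum-cong-≋ (λ j → distribʳ (w j) (u j) (v j)))
    (∑-distrib-+ (λ j → u j ⊙ w j) (λ j → v j ⊙ w j))

  ⟨⟩-distribˡ-+ : ∀ {N} (u v w : Vector Carrier N) →
                  ⟨ u , (λ j → v j ⊕ w j) ⟩ ≈ ⟨ u , v ⟩ ⊕ ⟨ u , w ⟩
  ⟨⟩-distribˡ-+ u v w = trans (sum-cong-≋ (λ j → distribˡ (u j) (v j) (w j)))
    (∑-distrib-+ (λ j → u j ⊙ v j) (λ j → u j ⊙ w j))

  ⟨⟩-assoc-* : ∀ {N} x (u v : Vector Carrier N) → ⟨ (λ j → x ⊙ u j) , v ⟩ ≈ x ⊙ ⟨ u , v ⟩
  ⟨⟩-assoc-* x u v = trans (sum-cong-≋ (λ j → *-assoc x (u j) (v j)))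
    (sym (*-distribˡ-sum x (λ j → u j ⊙ v j)))

  ⟨⟩-zeroˡ : ∀ {N} (v : Vector Carrier N) → ⟨ (λ _ → 0#) , v ⟩ ≈ 0#
  ⟨⟩-zeroˡ {N} v = trans (sum-cong-≋ (λ j → zeroˡ (v j))) (sum-replicate-zero N)

  ⟨⟩-zeroʳ : ∀ {N} (v : Vector Carrier N) → ⟨ v , (λ _ → 0#) ⟩ ≈ 0#
  ⟨⟩-zeroʳ {N} v = trans (sum-cong-≋ (λ j → zeroʳ (v j))) (sum-replicate-zero N)

  -- Applied to rows of a juxtaposition, this makes its Gram matrix the sum of the Gram matrices of
  -- the two halves.
  ⟨⟩-++ : ∀ {k l} (u v : Vector Carrier k) (u′ v′ : Vector Carrier l) →
          ⟨ u ++ u′ , v ++ v′ ⟩ ≈ ⟨ u , v ⟩ ⊕ ⟨ u′ , v′ ⟩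
  ⟨⟩-++ {zero}  u v u′ v′ = sym (+-identityˡ _)
  ⟨⟩-++ {suc k} u v u′ v′ = begin
    u zero ⊙ v zero ⊕ ⟨ tail (u ++ u′) , tail (v ++ v′) ⟩
      -- The two tails agree only pointwise: `_++_` is stuck on `splitAt` until the index is split.
      ≈⟨ +-congˡ (⟨⟩-cong (tail-++ u u′) (tail-++ v v′)) ⟩
    u zero ⊙ v zero ⊕ ⟨ tail u ++ u′ , tail v ++ v′ ⟩
      ≈⟨ +-congˡ (⟨⟩-++ (tail u) (tail v) u′ v′) ⟩
    u zero ⊙ v zero ⊕ (⟨ tail u , tail v ⟩ ⊕ ⟨ u′ , v′ ⟩)
      ≈⟨ +-assoc _ _ _ ⟨
    ⟨ u , v ⟩ ⊕ ⟨ u′ , v′ ⟩ ∎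
    where
    tail-++ : ∀ {k l} (u : Vector Carrier (suc k)) (u′ : Vector Carrier l) →
              tail (u ++ u′) ≋ (tail u ++ u′)
    tail-++ {k} u u′ j with splitAt k j
    ... | inj₁ _ = refl
    ... | inj₂ _ = refl

  -- Exchanging the two finite sums moves `G` across the inner product. For `v` a row `G i`, the
  -- right side is coordinate `i` of `a ⊛ (G ⊗ transpose G)`.
  ⟨⊛,⟩ : ∀ {n N} (a : Vector Carrier n) (G : Matrix Carrier n N) v →
         ⟨ a ⊛ G , v ⟩ ≈ ⟨ a , (λ i → ⟨ G i , v ⟩) ⟩
  ⟨⊛,⟩ {n} {N} a G v = begin
    ∑[ j < N ] (sum (λ i → a i ⊙ G i j) ⊙ v j)
      ≈⟨ sum-cong-≋ (λ j → *-distribʳ-sum (v j) (λ i → a i ⊙ G i j)) ⟩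
    ∑[ j < N ] ∑[ i < n ] (a i ⊙ G i j ⊙ v j)
      ≈⟨ ∑-comm (λ j i → a i ⊙ G i j ⊙ v j) ⟩
    ∑[ i < n ] ∑[ j < N ] (a i ⊙ G i j ⊙ v j)
      ≈⟨ sum-cong-≋ (λ i → ⟨⟩-assoc-* (a i) (G i) v) ⟩
    ∑[ i < n ] (a i ⊙ ⟨ G i , v ⟩) ∎

  ⟨⟩-comm : ∀ {N} (u v : Vector Carrier N) → ⟨ u , v ⟩ ≈ ⟨ v , u ⟩
  ⟨⟩-comm u v = sum-cong-≋ (λ j → *-comm (u j) (v j))

  -- Scalar matrices and matrices of the form αI + βJ.

  sum-supported : ∀ {n} (i : Fin n) (f : Vector Carrier n) →
                  (∀ k → k ≢ i → f k ≈ 0#) → sum f ≈ f i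
  sum-supported {suc n} i f f≈0 = begin
    sum f                        ≈⟨ sum-remove {i = i} f ⟩
    -- The remaining indices are values of `punchIn i`, which never hits `i`.
    f i ⊕ sum (removeAt f i)     ≈⟨ +-congˡ (sum-cong-≋ (λ k → f≈0 _ (punchInᵢ≢i i k))) ⟩
    f i ⊕ sum {n} (λ _ → 0#)     ≈⟨ +-congˡ (sum-replicate-zero n) ⟩
    f i ⊕ 0#                     ≈⟨ +-identityʳ _ ⟩
    f i                          ∎

  scalarMatrix-diagonal : ∀ {n} x (i : Fin n) → scalarMatrix n x i i ≈ x
  scalarMatrix-diagonal x i with i ≟ i
  ... | yes _  = refl
  ... | no i≢i = contradiction ≡.refl i≢i

  scalarMatrix-offDiagonal : ∀ {n} x {i j : Fin n} → i ≢ j → scalarMatrix n x i j ≈ 0#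
  scalarMatrix-offDiagonal x {i} {j} i≢j with i ≟ j
  ... | yes i≡j = contradiction i≡j i≢j
  ... | no _    = refl

  ⊛-scalarMatrix : ∀ {n} (a : Vector Carrier n) x j → (a ⊛ scalarMatrix n x) j ≈ a j ⊙ x
  ⊛-scalarMatrix a x j = trans
    (sum-supported j (λ k → a k ⊙ scalarMatrix _ x k j) (λ k k≢j →
      trans (*-congˡ (scalarMatrix-offDiagonal x k≢j)) (zeroʳ (a k))))
    (*-congˡ (scalarMatrix-diagonal x j))

  -- Rows of the identity matrix serve as coefficient vectors showing that each row of `G` lies in
  -- its row span.
  unit-⊛ : ∀ {n N} (G : Matrix Carrier n N) i → (scalarMatrix n 1# i ⊛ G) ≋ G i
  unit-⊛ G i j = trans
    (sum-supported i (λ k → scalarMatrix _ 1# i k ⊙ G k j) (λ k k≢i →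
      trans (*-congʳ (scalarMatrix-offDiagonal 1# (k≢i ∘ ≡.sym))) (zeroˡ (G k j))))
    (trans (*-congʳ (scalarMatrix-diagonal 1# i)) (*-identityˡ (G i j)))

  ⟨⟩-constʳ : ∀ {n} (a : Vector Carrier n) x → ⟨ a , (λ _ → x) ⟩ ≈ sum a ⊙ x
  ⟨⟩-constʳ a x = sym (*-distribʳ-sum x a)

  -- The form αI + βJ, with J the all-ones matrix.
  IsScalarPlusConstant : ∀ {n} → Carrier → Carrier → Matrix Carrier n n → Set ℓ
  IsScalarPlusConstant {n} α β M = ∀ i j → M i j ≈ scalarMatrix n α i j ⊕ β

  -- All columns of J are constant, so βJ sees `a` only through its coordinate sum.
  ⊛-scalarPlusConstant : ∀ {n α β} {M : Matrix Carrier n n} → IsScalarPlusConstant α β M →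
                         ∀ a j → (a ⊛ M) j ≈ a j ⊙ α ⊕ sum a ⊙ β
  ⊛-scalarPlusConstant {n} {α} {β} {M} M≈ a j = begin
    (a ⊛ M) j                                     ≈⟨ ⟨⟩-cong (λ _ → refl) (λ i → M≈ i j) ⟩
    ⟨ a , (λ i → scalarMatrix n α i j ⊕ β) ⟩      ≈⟨ ⟨⟩-distribˡ-+ a (λ i → scalarMatrix n α i j) (λ _ → β) ⟩
    (a ⊛ scalarMatrix n α) j ⊕ ⟨ a , (λ _ → β) ⟩  ≈⟨ +-cong (⊛-scalarMatrix a α j) (⟨⟩-constʳ a β) ⟩
    a j ⊙ α ⊕ sum a ⊙ β                           ∎

-- Left kernels and LCD codes over a field.

module _ {c ℓ₁ ℓ₂ : Level} (F : HeytingField c ℓ₁ ℓ₂) where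
  open HeytingField F using (tight; #⇒invertible)
  open CommutativeRing (fieldRing F) hiding (zero; _-_) renaming (_+_ to _⊕_; _*_ to _⊙_; -_ to ⊝_)
  open RingProperties ring using (-0#≈0#)
  open SemiringMult semiring using (×-comm-*) renaming (_×_ to _·_)
  open SemiringSum semiring
  open Codes F
  open LinearAlgebraProperties (fieldRing F)
  open Pointwise setoid using (_≋_)
  open ≈-Reasoning setoid

  -- Tightness reduces the goal to refuting that `x` is apart from `0#`; otherwise an inverse of `x`
  -- would cancel it and force `y ≈ 0#`.
  x*y≈0∧y≉0⇒x≈0 : ∀ {x y} → x ⊙ y ≈ 0# → ¬ (y ≈ 0#) → x ≈ 0#
  x*y≈0∧y≉0⇒x≈0 {x} {y} xy≈0 y≉0 = proj₁ (tight x 0#) λ x#0 →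
    let z , z[x-0]≈1 , _ = #⇒invertible x#0 in y≉0 (begin
      y                     ≈⟨ *-identityˡ y ⟨
      1# ⊙ y                ≈⟨ *-congʳ z[x-0]≈1 ⟨
      -- Apartness yields an inverse of the difference `x ⊕ ⊝ 0#`, which is then simplified to `x`.
      z ⊙ (x ⊕ ⊝ 0#) ⊙ y    ≈⟨ *-congʳ (*-congˡ (trans (+-congˡ -0#≈0#) (+-identityʳ x))) ⟩
      z ⊙ x ⊙ y             ≈⟨ *-assoc z x y ⟩
      z ⊙ (x ⊙ y)           ≈⟨ *-congˡ xy≈0 ⟩
      z ⊙ 0#                ≈⟨ zeroʳ z ⟩
      0#                    ∎)

  TrivialLeftKernel : ∀ {n k} → Matrix Carrier n k → Set _
  TrivialLeftKernel M = ∀ a → (a ⊛ M) ≋ (λ _ → 0#) → a ≋ (λ _ → 0#)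

  -- Multiplication by αI + βJ scales the coordinate sum by `α ⊕ n · β` and vectors of sum zero by
  -- `α`. The argument never divides by `n`, so it also covers characteristics dividing `n`.
  scalarPlusConstant-kernel : ∀ {n α β} {M : Matrix Carrier n n} → IsScalarPlusConstant α β M →
    ¬ (α ≈ 0#) → ¬ (α ⊕ n · β ≈ 0#) → TrivialLeftKernel M
  scalarPlusConstant-kernel {n} {α} {β} {M} M≈ α≉0 α+nβ≉0 a aM≈0 j =
    x*y≈0∧y≉0⇒x≈0 ajα≈0 α≉0
    where
    coordinate : ∀ j → a j ⊙ α ⊕ sum a ⊙ β ≈ 0#
    coordinate j = trans (sym (⊛-scalarPlusConstant M≈ a j)) (aM≈0 j)

    sum≈0 : sum a ≈ 0#
    -- Distributing recovers the sum of all `coordinate` equations, in which the constant term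
    -- `sum a ⊙ β` occurs `n` times.
    sum≈0 = x*y≈0∧y≉0⇒x≈0 (begin
      sum a ⊙ (α ⊕ n · β)                        ≈⟨ distribˡ _ _ _ ⟩
      sum a ⊙ α ⊕ sum a ⊙ (n · β)                ≈⟨ +-cong (*-distribʳ-sum α a) (×-comm-* n (sum a) β) ⟩
      sum (λ i → a i ⊙ α) ⊕ n · (sum a ⊙ β)      ≈⟨ +-congˡ (sum-replicate n) ⟨
      sum (λ i → a i ⊙ α) ⊕ sum {n} (λ _ → sum a ⊙ β)
                                                 ≈⟨ ∑-distrib-+ (λ i → a i ⊙ α) (λ _ → sum a ⊙ β) ⟨
      sum (λ i → a i ⊙ α ⊕ sum a ⊙ β)            ≈⟨ sum-cong-≋ coordinate ⟩
      sum {n} (λ _ → 0#)                         ≈⟨ sum-replicate-zero n ⟩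
      0#                                         ∎) α+nβ≉0

    ajα≈0 : a j ⊙ α ≈ 0#
    ajα≈0 = begin
      a j ⊙ α                ≈⟨ +-identityʳ _ ⟨
      a j ⊙ α ⊕ 0#           ≈⟨ +-congˡ (trans (*-congʳ sum≈0) (zeroˡ β)) ⟨
      a j ⊙ α ⊕ sum a ⊙ β    ≈⟨ coordinate j ⟩
      0#                     ∎

  rowSpan-isLinearCode : ∀ {n N} (G : Matrix Carrier n N) → IsLinearCode (rowSpan G)
  rowSpan-isLinearCode G = record
    { resp     = λ u≋v (a , u≋aG) → a , λ j → trans (sym (u≋v j)) (u≋aG j)
    ; 0-closed = (λ _ → 0#) , λ j → sym (⟨⟩-zeroˡ (λ i → G i j))
    ; +-closed = λ (a , u≋aG) (b , v≋bG) → (λ i → a i ⊕ b i) ,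
                 λ j → trans (+-cong (u≋aG j) (v≋bG j)) (sym (⟨⟩-distribʳ-+ a b (λ i → G i j)))
    ; *-closed = λ x (a , v≋aG) → (λ i → x ⊙ a i) ,
                 λ j → trans (*-congˡ (v≋aG j)) (sym (⟨⟩-assoc-* x a (λ i → G i j)))
    }

  -- One direction of Massey's criterion for LCD codes, with nonsingularity of the Gram matrix
  -- expressed as a trivial left kernel.
  gram-kernel⇒isLCD : ∀ {n N} (G : Matrix Carrier n N) →
                      TrivialLeftKernel (G ⊗ transpose G) → IsLCD (rowSpan G)
  gram-kernel⇒isLCD G kernel = record
    { isLinearCode      = rowSpan-isLinearCode G
    ; complementaryDual = self-orthogonal⇒0 , 0⇒self-orthogonal
    }
    where
    self-orthogonal⇒0 : ∀ {v} → rowSpan G v × (rowSpan G ⊥) v → v ≋ (λ _ → 0#)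
    self-orthogonal⇒0 {v} ((a , v≋aG) , v⊥) j =
      trans (v≋aG j) (trans (⟨⟩-cong {v = λ i → G i j} a≋0 (λ _ → refl)) (⟨⟩-zeroˡ (λ i → G i j)))
      where
      a≋0 : a ≋ (λ _ → 0#)
      a≋0 = kernel a λ i → begin
        (a ⊛ (G ⊗ transpose G)) i   ≈⟨ ⟨⊛,⟩ a G (G i) ⟨
        ⟨ a ⊛ G , G i ⟩             ≈⟨ ⟨⟩-cong (λ k → sym (v≋aG k)) (λ _ → refl) ⟩
        ⟨ v , G i ⟩                 ≈⟨ ⟨⟩-comm v (G i) ⟩
        -- Row `G i` is a codeword by `unit-⊛`. The definition of `_⊥` pairs the codeword on the
        -- left, hence the preceding swap.
        ⟨ G i , v ⟩                 ≈⟨ v⊥ (G i) (scalarMatrix _ 1# i , λ k → sym (unit-⊛ G i k)) ⟩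
        0#                          ∎

    0⇒self-orthogonal : ∀ {v} → v ≋ (λ _ → 0#) → rowSpan G v × (rowSpan G ⊥) v
    0⇒self-orthogonal v≋0 =
      IsLinearCode.resp (rowSpan-isLinearCode G) (λ j → sym (v≋0 j))
        (IsLinearCode.0-closed (rowSpan-isLinearCode G)) ,
      λ u _ → trans (⟨⟩-cong (λ _ → refl) v≋0) (⟨⟩-zeroʳ u)

-- Gram matrices of incidence and weighing matrices over ℤ.

indicator : Bool → ℤ
indicator p = if p then 1ℤ else 0ℤ

indicator-∧ : ∀ p q → indicator p * indicator q ≡ indicator (p ∧ q)
indicator-∧ true  true  = ≡.refl
indicator-∧ true  false = ≡.refl
indicator-∧ false true  = ≡.refl
indicator-∧ false false = ≡.refl

module ℤ∑ = SemiringSum (CommutativeRing.semiring +-*-commutativeRing)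

-- Links the sums in Gram entries to the `count`s in the design axioms.
sum-indicator : ∀ {a p N} {A : Set a} {P : Pred A p} (P? : Decidable P) (xs : Vec A N) →
                ℤ∑.sum (λ j → indicator (does (P? (Vec.lookup xs j)))) ≡ + count P? xs
sum-indicator P? []       = ≡.refl
sum-indicator P? (x ∷ xs) with does (P? x)
... | true  = cong (λ k → 1ℤ + k) (sum-indicator P? xs)
... | false = ≡.trans (ℤ.+-identityˡ _) (sum-indicator P? xs)

module _ where
  open LinearAlgebra +-*-commutativeRing

  -- Two rows overlap exactly in the blocks through both points, and a row overlaps itself in the
  -- blocks through its point. The difference is taken in ℤ because with a single point `balance` is
  -- vacuous and `lam` may exceed `r`.
  incidence-gram : ∀ {n b r lam} (D : Design n b r lam) x y →
    (incidence D ⊗ transpose (incidence D)) x y ≡ scalarMatrix n (+ r - + lam) x y + + lam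
  incidence-gram {r = r} {lam} D x y with x ≟ y
  ... | yes ≡.refl = begin
    ⟨ incidence D x , incidence D x ⟩                              ≡⟨ ℤ∑.sum-cong-≗ square ⟩
    ℤ∑.sum (incidence D x)                                         ≡⟨ sum-indicator (x ∈?_) blocks ⟩
    + count (x ∈?_) blocks                                         ≡⟨ cong +_ (replication x) ⟩
    -- The constant part λJ covers the diagonal too, so `+ lam` has to be split off from `+ r`.
    + r                                                            ≡⟨ i≡i-j+j (+ r) (+ lam) ⟩
    + r - + lam + + lam                                            ∎
    where
    open Design D
    open ≡-Reasoning
    square : ∀ j → incidence D x j * incidence D x j ≡ incidence D x j
    square j = ≡.trans (indicator-∧ p p) (cong indicator (∧-idem p))
      where p = does (x ∈? Vec.lookup blocks j)
    i≡i-j+j : ∀ i j → i ≡ i - j + j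
    i≡i-j+j = solve-∀
  ... | no x≢y = begin
    ⟨ incidence D x , incidence D y ⟩                              ≡⟨ ℤ∑.sum-cong-≗ both ⟩
    ℤ∑.sum (λ j → indicator (does (both? (Vec.lookup blocks j))))  ≡⟨ sum-indicator both? blocks ⟩
    + count both? blocks                                           ≡⟨ cong +_ (balance x y x≢y) ⟩
    + lam                                                          ≡⟨ ℤ.+-identityˡ (+ lam) ⟨
    0ℤ + + lam                                                     ∎
    where
    open Design D
    open ≡-Reasoning
    both? = λ β → (x ∈? β) ×-dec (y ∈? β)
    both : ∀ j → incidence D x j * incidence D y j ≡ indicator (does (both? (Vec.lookup blocks j)))
    -- `does` of a `_×-dec_` reduces to the conjunction of the two `does` values.
    both j = indicator-∧ (does (x ∈? Vec.lookup blocks j)) (does (y ∈? Vec.lookup blocks j))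

  scalarMatrix-+ : ∀ n k l i j → scalarMatrix n k i j + scalarMatrix n l i j ≡ scalarMatrix n (k + l) i j
  scalarMatrix-+ n k l i j with does (i ≟ j)
  ... | true  = ≡.refl
  ... | false = ≡.refl

  -- The weighing matrix contributes mI, which changes only the scalar part and leaves λJ as it is.
  gram-sum : ∀ {n m b r lam} {W : Matrix ℤ n n} → IsWeighing W m → (D : Design n b r lam) → ∀ i j →
    (W ⊗ transpose W) i j + (incidence D ⊗ transpose (incidence D)) i j
      ≡ scalarMatrix n (+ r - + lam + + m) i j + + lam
  gram-sum {n} {m} {r = r} {lam} {W} isW D i j = begin
    (W ⊗ transpose W) i j + (incidence D ⊗ transpose (incidence D)) i j
      ≡⟨ cong₂ _+_ (IsWeighing.gram isW i j) (incidence-gram D i j) ⟩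
    scalarMatrix n (+ m) i j + (scalarMatrix n (+ r - + lam) i j + + lam)
      ≡⟨ ℤ.+-assoc (scalarMatrix n (+ m) i j) _ (+ lam) ⟨
    scalarMatrix n (+ m) i j + scalarMatrix n (+ r - + lam) i j + + lam
      ≡⟨ cong (_+ + lam) (scalarMatrix-+ n (+ m) (+ r - + lam) i j) ⟩
    scalarMatrix n (+ m + (+ r - + lam)) i j + + lam
      ≡⟨ cong (λ k → scalarMatrix n k i j + + lam) (ℤ.+-comm (+ m) (+ r - + lam)) ⟩
    scalarMatrix n (+ r - + lam + + m) i j + + lam ∎
    where open ≡-Reasoning

theorem3p4 : {c ℓ₁ ℓ₂ : Level} (F : HeytingField c ℓ₁ ℓ₂) (q : ℕ) → HasOrder F q →
    let open Codes F in
    (n m b r lam : ℕ) (W : Matrix ℤ n n) → IsWeighing W m →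
    (D : Design n b r lam) →
    + r + (+ n - 1ℤ) * + lam + + m ≠0 →
    + r - + lam + + m ≠0 →
    IsLCD (rowSpan [ interpret W ∣ interpret (incidence D) ])
theorem3p4 F q _ n m b r lam W isW D total≠0 diff≠0 =
  -- With α = r - λ + m, the quantity r + (n - 1)λ + m equals α + nλ, the form that the kernel lemma
  -- asks for; `total≈` makes this conversion.
  gram-kernel⇒isLCD F G (scalarPlusConstant-kernel F gram diff≠0 (total≠0 ∘ trans total≈))
  where
  open CommutativeRing (fieldRing F) hiding (zero; _-_; -_) renaming (_+_ to _⊕_; _*_ to _⊙_)
  open SemiringMult semiring using (×-assoc-*; ×-congʳ) renaming (_×_ to _·_)
  open Codes F
  open LinearAlgebraProperties (fieldRing F)
  open ≈-Reasoning setoid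
  module ℤM = LinearAlgebra +-*-commutativeRing

  B = incidence D
  G = [ interpret W ∣ interpret B ]
  α = + r - + lam + + m

  gram : IsScalarPlusConstant (fromℤ α) (fromℤ (+ lam)) (G ⊗ transpose G)
  gram i j = begin
    ⟨ G i , G j ⟩
      ≈⟨ ⟨⟩-++ (interpret W i) (interpret W j) (interpret B i) (interpret B j) ⟩
    ⟨ interpret W i , interpret W j ⟩ ⊕ ⟨ interpret B i , interpret B j ⟩
      ≈⟨ +-cong (fromℤ-⟨⟩ (W i) (W j)) (fromℤ-⟨⟩ (B i) (B j)) ⟩
    fromℤ ℤM.⟨ W i , W j ⟩ ⊕ fromℤ ℤM.⟨ B i , B j ⟩
      -- The two entries are merged under one `fromℤ`, so that the integer identity `gram-sum`
      -- applies.
      ≈⟨ fromℤ-+ ℤM.⟨ W i , W j ⟩ ℤM.⟨ B i , B j ⟩ ⟨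
    fromℤ (ℤM.⟨ W i , W j ⟩ + ℤM.⟨ B i , B j ⟩)
      ≡⟨ cong fromℤ (gram-sum isW D i j) ⟩
    fromℤ (ℤM.scalarMatrix n α i j + + lam)
      ≈⟨ fromℤ-+ (ℤM.scalarMatrix n α i j) (+ lam) ⟩
    fromℤ (ℤM.scalarMatrix n α i j) ⊕ fromℤ (+ lam)
      ≈⟨ +-congʳ (fromℤ-scalarMatrix n α i j) ⟩
    scalarMatrix n (fromℤ α) i j ⊕ fromℤ (+ lam) ∎

  regroup : ∀ r n l m → r + (n - 1ℤ) * l + m ≡ r - l + m + n * l
  regroup = solve-∀

  total≈ : fromℤ (+ r + (+ n - 1ℤ) * + lam + + m) ≈ fromℤ α ⊕ n · fromℤ (+ lam)
  total≈ = begin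
    fromℤ (+ r + (+ n - 1ℤ) * + lam + + m)    ≡⟨ cong fromℤ (regroup (+ r) (+ n) (+ lam) (+ m)) ⟩
    fromℤ (α + + n * + lam)                   ≈⟨ fromℤ-+ α (+ n * + lam) ⟩
    fromℤ α ⊕ fromℤ (+ n * + lam)             ≈⟨ +-congˡ (fromℤ-* (+ n) (+ lam)) ⟩
    -- `fromℤ (+ n)` unfolds to `n · 1#`, so multiplying by it turns into `n`-fold addition.
    fromℤ α ⊕ n · 1# ⊙ fromℤ (+ lam)          ≈⟨ +-congˡ (×-assoc-* n 1# (fromℤ (+ lam))) ⟩
    fromℤ α ⊕ n · (1# ⊙ fromℤ (+ lam))        ≈⟨ +-congˡ (×-congʳ n (*-identityˡ (fromℤ (+ lam)))) ⟩
    fromℤ α ⊕ n · fromℤ (+ lam)               ∎
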